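{- Let $A$ be an $m\times n$ polyomino. Then the diagram of $A$ is (the set of positions of) a Ferrers array $F$, and the ranked essential set of $A$ consists of the lower right corners of $F$, each with rank $0$. Furthermore, for nonnegative integral vectors $R,S$, a polyomino $A\in\mathcal{C}_{m,n}(R,S)$ is uniquely determined by its ranked essential set; that is, two polyominoes in $\mathcal{C}_{m,n}(R,S)$ with the same ranked essential set are equal.
   Context: A $(0,1)$-matrix is convex if in every row and every column the 1's occur consecutively. It is connected if it has no zero row and no zero column and every two 1's are joined by a path of 1's in which consecutive 1's are horizontally or vertically adjacent. A polyomino is a connected convex $(0,1)$-matrix. $\mathcal{C}_{m,n}(R,S)$ is the set of convex $m\times n$ $(0,1)$-matrices with row sum vector $R$ and column sum vector $S$. A Ferrers array $F(U)$ for a nonincreasing nonnegative integer vector $U=(u_1,\dots,u_m)$ is the set of positions $\{(i,j): 1\le j\le u_i\}$ (left-justified rows of lengths $u_i$); its lower right corners are the positions $(i,u_i)$ with $u_i>u_{i+1}$ (where $u_{m+1}=0$). The diagram of an $m\times n$ $(0,1)$-matrix $A$: for each 1 of $A$ at $(i,j)$ shade all positions $(i,j')$, $j'\ge j$, and $(i',j)$, $i'\ge i$; the diagram is the set of unshaded positions. The essential set is the set of positions $(i,j)$ of the diagram such that neither $(i+1,j)$ nor $(i,j+1)$ lies in the diagram; the ranked essential set consists of the triples $(i,j;r)$ with $(i,j)$ in the essential set and $r$ the number of 1's of $A$ in rows $1,\dots,i$ and columns $1,\dots,j$. -}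

module Defs where

open import Data.Bool.Base using (Bool; true; _∧_; if_then_else_)
open import Data.Fin.Base using (Fin; suc; toℕ; _≤_)
open import Data.Fin.Properties using (_≤?_)
open import Data.Nat.Base as ℕ using (ℕ)
open import Data.Nat.Properties using (+-0-monoid)
open import Data.Product.Base using (_×_; _,_; ∃)
open import Data.Sum.Base using (_⊎_)
open import Data.Vec.Base using (Vec; lookup; _∷ʳ_)
open import Relation.Binary.Construct.Closure.ReflexiveTransitive using (Star)
open import Relation.Binary.PropositionalEquality.Core using (_≡_)
open import Relation.Nullary using (¬_; does)
open import Relation.Unary using (Pred)
open import Level using (0ℓ)

open import Algebra.Properties.Monoid.Sum +-0-monoid using (sum-syntax)

-- Indices are 0-based: the element i of Fin m stands for row toℕ i + 1 of
-- the usual 1-based numbering, and likewise for columns.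

Matrix : ℕ → ℕ → Set
Matrix m n = Vec (Vec Bool n) m

Position : ℕ → ℕ → Set
Position m n = Fin m × Fin n

entry : ∀ {m n} → Matrix m n → Position m n → Bool
entry A (i , j) = lookup (lookup A i) j

One : ∀ {m n} → Matrix m n → Pred (Position m n) 0ℓ
One A p = entry A p ≡ true

bit : Bool → ℕ
bit b = if b then 1 else 0

rowSum : ∀ {m n} → Matrix m n → Fin m → ℕ
rowSum {m} {n} A i = ∑[ j < n ] bit (entry A (i , j))

colSum : ∀ {m n} → Matrix m n → Fin n → ℕ
colSum {m} {n} A j = ∑[ i < m ] bit (entry A (i , j))

record Convex {m n : ℕ} (A : Matrix m n) : Set where
  field
    rows : ∀ i {j₁ j₂ j₃} → j₁ ≤ j₂ → j₂ ≤ j₃ →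
           One A (i , j₁) → One A (i , j₃) → One A (i , j₂)
    cols : ∀ j {i₁ i₂ i₃} → i₁ ≤ i₂ → i₂ ≤ i₃ →
           One A (i₁ , j) → One A (i₃ , j) → One A (i₂ , j)

Consecutive : ∀ {k} → Fin k → Fin k → Set
Consecutive a b = toℕ b ≡ ℕ.suc (toℕ a)

Adjacent : ∀ {m n} → Position m n → Position m n → Set
Adjacent (i , j) (i′ , j′) =
    (i ≡ i′ × (Consecutive j j′ ⊎ Consecutive j′ j))
  ⊎ (j ≡ j′ × (Consecutive i i′ ⊎ Consecutive i′ i))

Step : ∀ {m n} → Matrix m n → Position m n → Position m n → Set
Step A p q = One A p × One A q × Adjacent p q

record Connected {m n : ℕ} (A : Matrix m n) : Set where
  field
    noZeroRow : ∀ i → ∃ λ j → One A (i , j)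
    noZeroCol : ∀ j → ∃ λ i → One A (i , j)
    path      : ∀ p q → One A p → One A q → Star (Step A) p q

record Polyomino {m n : ℕ} (A : Matrix m n) : Set where
  field
    connected : Connected A
    convex    : Convex A

record 𝒞 {m n : ℕ} (R : Vec ℕ m) (S : Vec ℕ n) (A : Matrix m n) : Set where
  field
    convex  : Convex A
    rowSums : ∀ i → rowSum A i ≡ lookup R i
    colSums : ∀ j → colSum A j ≡ lookup S j

Shaded : ∀ {m n} → Matrix m n → Pred (Position m n) 0ℓ
Shaded A (i , j) =
    (∃ λ j₀ → j₀ ≤ j × One A (i , j₀))
  ⊎ (∃ λ i₀ → i₀ ≤ i × One A (i₀ , j))

Diagram : ∀ {m n} → Matrix m n → Pred (Position m n) 0ℓ
Diagram A p = ¬ Shaded A p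

-- A neighbour falling outside the m × n grid is not in the diagram, so only
-- neighbours that exist impose a condition.
Essential : ∀ {m n} → Matrix m n → Pred (Position m n) 0ℓ
Essential A (i , j) =
    Diagram A (i , j)
  × (∀ i′ → Consecutive i i′ → ¬ Diagram A (i′ , j))
  × (∀ j′ → Consecutive j j′ → ¬ Diagram A (i , j′))

rank : ∀ {m n} → Matrix m n → Position m n → ℕ
rank {m} {n} A (i , j) =
  ∑[ k < m ] ∑[ l < n ] bit (does (k ≤? i) ∧ does (l ≤? j) ∧ entry A (k , l))

RankedEssential : ∀ {m n} → Matrix m n → Pred (Position m n × ℕ) 0ℓ
RankedEssential A (p , r) = Essential A p × r ≡ rank A p

-- The last field makes the Ferrers array F(U) fit in n columns; without it
-- `Ferrers U` below would only be the part of F(U) inside the m × n grid.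
record FerrersVector {m : ℕ} (n : ℕ) (U : Vec ℕ m) : Set where
  field
    nonincreasing : ∀ {i i′} → i ≤ i′ → lookup U i′ ℕ.≤ lookup U i
    fits          : ∀ i → lookup U i ℕ.≤ n

-- The 1-based column number toℕ j + 1 is at most uᵢ.
Ferrers : ∀ {m n} → Vec ℕ m → Pred (Position m n) 0ℓ
Ferrers U (i , j) = toℕ j ℕ.< lookup U i

-- U ∷ʳ 0 extends U by u_{m+1} = 0, so its entry at `suc i` is u_{i+1}.
LowerRightCorner : ∀ {m n} → Vec ℕ m → Pred (Position m n) 0ℓ
LowerRightCorner U (i , j) =
    ℕ.suc (toℕ j) ≡ lookup U i
  × lookup (U ∷ʳ 0) (suc i) ℕ.< lookup U i

{-# OPTIONS --safe #-}

-- Fix an unshaded position (i , j). A path of 1's that starts strictly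
-- north-west of it can leave that quadrant only through row i left of column
-- j or through column j above row i, where A has no 1's. As row i does contain
-- a 1, there are no 1's weakly north-west of (i , j) at all; hence the diagram
-- is a Ferrers array and its positions have rank 0.
--
-- For uniqueness, the essential set determines the diagram. A row or column is
-- an interval, so it is determined by its sum and its first 1. Let f be the
-- first row with a 1 in the first column. In the rows up to f the first 1 is
-- the first shaded position, so these rows, and then the first column, are
-- determined. If the first a rows and the first b columns are determined and
-- contain the 1 at (f , 0) in common, a path from it out of that quadrant
-- starts row a + 1 or column b + 1 at a determined place, so a or b can be
-- increased.

module Submission where

open import Defs
open import Data.Bool.Base using (Bool; true; false; _∧_)
open import Data.Bool.Properties as Bool using (⇔→≡)
open import Data.Fin.Base as Fin using (Fin; zero; suc; toℕ; fromℕ<)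
open import Data.Fin.Properties as Fin using (any?; toℕ-injective; toℕ-fromℕ<; toℕ<n)
open import Data.Nat.Base as ℕ using (ℕ; zero; suc; _+_; z≤n; s≤s)
open import Data.Nat.Properties as ℕ using (+-0-monoid)
open import Data.Product.Base using (_×_; _,_; ∃; ∃₂; proj₁; proj₂)
open import Data.Sum.Base using (_⊎_; inj₁; inj₂)
open import Data.Vec.Base using (Vec; []; _∷_; lookup; tabulate; _∷ʳ_)
open import Data.Vec.Properties using (lookup∘tabulate)
open import Data.Vec.Relation.Binary.Pointwise.Extensional using (ext; Pointwise-≡⇒≡)
open import Function.Base using (_∘_; case_of_)
open import Function.Bundles using (_⇔_; mk⇔; Equivalence)
open import Level using (0ℓ)
open import Relation.Binary.Construct.Closure.ReflexiveTransitive using (Star; ε; _◅_)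
open import Relation.Binary.PropositionalEquality.Core using (_≡_; refl; sym; trans; cong; subst)
open import Relation.Nullary using (¬_; Dec; yes; no; does; contradiction)
open import Relation.Nullary.Decidable using (_×-dec_; _⊎-dec_; ¬?; decidable-stable)
open import Relation.Unary using (Pred; Decidable; _≐_)

open import Algebra.Properties.Monoid.Sum +-0-monoid using (sum)

-- Finite sums and intervals

sum-zero : ∀ {n} {f : Fin n → ℕ} → (∀ i → f i ≡ 0) → sum f ≡ 0
sum-zero {zero}  f≡0 = refl
sum-zero {suc n} f≡0 rewrite f≡0 zero = sum-zero (f≡0 ∘ suc)

sum-mono-≤ : ∀ {n} {f g : Fin n → ℕ} → (∀ i → f i ℕ.≤ g i) → sum f ℕ.≤ sum g
sum-mono-≤ {zero}  f≤g = z≤n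
sum-mono-≤ {suc n} f≤g = ℕ.+-mono-≤ (f≤g zero) (sum-mono-≤ (f≤g ∘ suc))

sum-mono-< : ∀ {n} {f g : Fin n → ℕ} → (∀ i → f i ℕ.≤ g i) →
             ∀ k → f k ℕ.< g k → sum f ℕ.< sum g
sum-mono-< f≤g zero    f<g = ℕ.+-mono-<-≤ f<g (sum-mono-≤ (f≤g ∘ suc))
sum-mono-< f≤g (suc k) f<g = ℕ.+-mono-≤-< (f≤g zero) (sum-mono-< (f≤g ∘ suc) k f<g)

bit-mono : ∀ {x y} → (x ≡ true → y ≡ true) → bit x ℕ.≤ bit y
bit-mono {false} x⇒y = z≤n
bit-mono {true}  x⇒y rewrite x⇒y refl = ℕ.≤-refl

Interval : ∀ {n} → (Fin n → Bool) → Set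
Interval x = ∀ {j₁ j₂ j₃} → j₁ Fin.≤ j₂ → j₂ Fin.≤ j₃ →
             x j₁ ≡ true → x j₃ ≡ true → x j₂ ≡ true

module _ {n} {x y : Fin n → Bool} (x-int : Interval x) (y-int : Interval y)
         (∑x≡∑y : sum (bit ∘ x) ≡ sum (bit ∘ y)) {j : Fin n}
         (xj : x j ≡ true) (yj : y j ≡ true)
         (x≡y : ∀ l → l Fin.≤ j → x l ≡ y l) where

  -- If `y` missed a `k` in `x`, then `k` would lie beyond `j`, and the interval `y` through `j`
  -- would stop before `k`. So `y` would be contained in `x` without `k`, and its sum would be
  -- smaller.
  interval-⊆ : ∀ k → x k ≡ true → y k ≡ true
  interval-⊆ k xk with y k in yk
  ... | true  = refl
  ... | false = contradiction (sym ∑x≡∑y) (ℕ.<⇒≢ (sum-mono-< (bit-mono ∘ y⊆x) k y<x))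
    where
    ¬yk : ¬ y k ≡ true
    ¬yk yk′ = case trans (sym yk) yk′ of λ ()
    y<x : bit (y k) ℕ.< bit (x k)
    y<x rewrite yk | xk = ℕ.≤-refl
    j≤k : j Fin.≤ k
    j≤k = ℕ.≮⇒≥ λ k<j → ¬yk (trans (sym (x≡y k (ℕ.<⇒≤ k<j))) xk)
    y⊆x : ∀ l → y l ≡ true → x l ≡ true
    y⊆x l yl with l Fin.≤? j | l Fin.≤? k
    ... | yes l≤j | _       = trans (x≡y l l≤j) yl
    ... | no  l≰j | yes l≤k = x-int (ℕ.≰⇒≥ l≰j) l≤k xj xk
    ... | no  l≰j | no  l≰k = contradiction (y-int j≤k (ℕ.≰⇒≥ l≰k) yj yl) ¬yk

interval-unique : ∀ {n} {x y : Fin n → Bool} → Interval x → Interval y →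
                  sum (bit ∘ x) ≡ sum (bit ∘ y) → ∀ {j} → x j ≡ true → y j ≡ true →
                  (∀ l → l Fin.≤ j → x l ≡ y l) → ∀ k → x k ≡ y k
interval-unique x-int y-int ∑≡ xj yj x≡y k = ⇔→≡ (mk⇔
  (interval-⊆ x-int y-int ∑≡ xj yj x≡y k)
  (interval-⊆ y-int x-int (sym ∑≡) yj xj (λ l → sym ∘ x≡y l) k))

-- Decidable predicates on Fin n

least : ∀ {n} {P : Pred (Fin n) 0ℓ} → Decidable P → ∃ P →
        ∃ λ i → P i × (∀ j → j Fin.< i → ¬ P j)
least {suc n} P? (i , pi) with P? zero
... | yes p0 = zero , p0 , λ _ ()
least {suc n} P? (zero  , p0) | no ¬p0 = contradiction p0 ¬p0
least {suc n} P? (suc i , pi) | no ¬p0 with least (P? ∘ suc) (i , pi)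
... | k , pk , k-least = suc k , pk , λ where
  zero    _         → ¬p0
  (suc j) (s≤s j<k) → k-least j j<k

downset-initial : ∀ {n} {P : Pred (Fin n) 0ℓ} → Decidable P →
                  (∀ {j k} → j Fin.≤ k → P k → P j) →
                  ∃ λ u → u ℕ.≤ n × (∀ j → P j ⇔ toℕ j ℕ.< u)
downset-initial {zero}  P? down = 0 , z≤n , λ ()
downset-initial {suc n} P? down with P? zero
... | no ¬p0 = 0 , z≤n , λ j → mk⇔ (λ pj → contradiction (down z≤n pj) ¬p0) λ ()
... | yes p0 with downset-initial (P? ∘ suc) (down ∘ s≤s)
...   | u , u≤n , P⇔<u = suc u , s≤s u≤n , λ where
  zero    → mk⇔ (λ _ → s≤s z≤n) (λ _ → p0)
  (suc j) → mk⇔ (s≤s ∘ Equivalence.to (P⇔<u j)) (Equivalence.from (P⇔<u j) ∘ ℕ.≤-pred)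

-- At index `suc i` this separates the rows that have a row below them from the last row, where the
-- appended entry is read.
lookup-∷ʳ : ∀ {m} {X : Set} (U : Vec X m) (x : X) k →
            (∃ λ i → toℕ i ≡ toℕ k × lookup (U ∷ʳ x) k ≡ lookup U i)
          ⊎ (toℕ k ≡ m × lookup (U ∷ʳ x) k ≡ x)
lookup-∷ʳ []      x zero    = inj₂ (refl , refl)
lookup-∷ʳ (u ∷ U) x zero    = inj₁ (zero , refl , refl)
lookup-∷ʳ (u ∷ U) x (suc k) with lookup-∷ʳ U x k
... | inj₁ (i , i≡k , eq) = inj₁ (suc i , cong suc i≡k , eq)
... | inj₂ (k≡m , eq)     = inj₂ (cong suc k≡m , eq)

-- Paths

exit : ∀ {X : Set} {T : X → X → Set} {P : Pred X 0ℓ} → Decidable P →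
       ∀ {p q} → Star T p q → P p → ¬ P q → ∃₂ λ p′ q′ → P p′ × ¬ P q′ × T p′ q′
exit P? ε pp ¬pq = contradiction pp ¬pq
exit P? (_◅_ {j = r} t ts) pp ¬pq with P? r
... | yes pr = exit P? ts pr ¬pq
... | no ¬pr = _ , _ , pp , ¬pr , t

one? : ∀ {m n} (A : Matrix m n) → Decidable (One A)
one? A p = entry A p Bool.≟ true

shaded? : ∀ {m n} (A : Matrix m n) → Decidable (Shaded A)
shaded? A (i , j) = any? (λ j₀ → j₀ Fin.≤? j ×-dec one? A (i , j₀))
              ⊎-dec any? (λ i₀ → i₀ Fin.≤? i ×-dec one? A (i₀ , j))

diagram? : ∀ {m n} (A : Matrix m n) → Decidable (Diagram A)
diagram? A p = ¬? (shaded? A p)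

-- The first step out of the quadrant changes one coordinate by one and must increase it. It
-- therefore lands exactly on row `a` or column `b`, with the other coordinate still in range.
leaves-quadrant : ∀ {m n} (A : Matrix m n) a b {i j p} → Star (Step A) (i , j) p →
                  toℕ i ℕ.< a → toℕ j ℕ.< b →
                  ¬ (toℕ (proj₁ p) ℕ.< a × toℕ (proj₂ p) ℕ.< b) →
                  ∃₂ λ k l → One A (k , l)
                    × (toℕ k ≡ a × toℕ l ℕ.< b ⊎ toℕ k ℕ.< a × toℕ l ≡ b)
leaves-quadrant _ a b path i<a j<b p∉
  with exit (λ (k , l) → toℕ k ℕ.<? a ×-dec toℕ l ℕ.<? b) path (i<a , j<b) p∉
... | _ , (k , l) , (k<a , l′<b) , q∉ , _ , 1q , inj₁ (refl , inj₁ l≡) =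
  k , l , 1q , inj₂ (k<a , ℕ.≤-antisym (subst (ℕ._≤ b) (sym l≡) l′<b) (ℕ.≮⇒≥ λ l<b → q∉ (k<a , l<b)))
... | _ , _ , (k<a , l′<b) , q∉ , _ , _ , inj₁ (refl , inj₂ l′≡) =
  contradiction (k<a , ℕ.<-trans (ℕ.≤-reflexive (sym l′≡)) l′<b) q∉
... | _ , (k , l) , (k′<a , l<b) , q∉ , _ , 1q , inj₂ (refl , inj₁ k≡) =
  k , l , 1q , inj₁ (ℕ.≤-antisym (subst (ℕ._≤ a) (sym k≡) k′<a) (ℕ.≮⇒≥ λ k<a → q∉ (k<a , l<b)) , l<b)
... | _ , _ , (k′<a , l<b) , q∉ , _ , _ , inj₂ (refl , inj₂ k′≡) =
  contradiction (ℕ.<-trans (ℕ.≤-reflexive (sym k′≡)) k′<a , l<b) q∉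

FirstInRow : ∀ {m n} → Matrix m n → Pred (Position m n) 0ℓ
FirstInRow A (i , c) = One A (i , c) × (∀ l → l Fin.< c → ¬ One A (i , l))

-- A path from left of column c, on one side S of row i, to the first 1 of
-- row i cannot cross row i left of column c, so it uses column c - 1 within S.
uses-previous-column :
  ∀ {m n} (A : Matrix m n) {i c} → FirstInRow A (i , c) →
  {S : Pred (Fin m) 0ℓ} → Decidable S →
  (∀ {k k′} → S k → ¬ S k′ → Consecutive k k′ ⊎ Consecutive k′ k → k′ ≡ i) →
  ∀ {k l} → Star (Step A) (k , l) (i , c) → S k → l Fin.< c →
  ∃₂ λ k l → S k × suc (toℕ l) ≡ toℕ c × One A (k , l)
uses-previous-column _ {c = c} (_ , first) S? boundary path Sk l<c
  with exit (λ (k , l) → S? k ×-dec l Fin.<? c) path (Sk , l<c) (ℕ.<-irrefl refl ∘ proj₂)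
... | (k , l) , _ , (Sk , l<c) , q∉ , 1p , _ , inj₁ (refl , inj₁ l′≡) =
  k , l , Sk , ℕ.≤-antisym l<c (subst (toℕ c ℕ.≤_) l′≡ (ℕ.≮⇒≥ λ l′<c → q∉ (Sk , l′<c))) , 1p
... | _ , _ , (Sk , l<c) , q∉ , _ , _ , inj₁ (refl , inj₂ l≡) =
  contradiction (Sk , ℕ.<-trans (ℕ.≤-reflexive (sym l≡)) l<c) q∉
... | _ , _ , (Sk , l<c) , q∉ , _ , 1q , inj₂ (refl , adj)
  with refl ← boundary Sk (λ Sk′ → q∉ (Sk′ , l<c)) adj = contradiction 1q (first _ l<c)

-- Shading, essential positions and first 1's of a polyomino

module PolyominoProperties {m n} {A : Matrix m n} (poly : Polyomino A) where
  open Polyomino poly public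
  open Connected connected public
  open Convex convex public

  diagram-zero : ∀ {i j i′ j′} → i′ Fin.≤ i → j′ Fin.≤ j → Diagram A (i , j) → ¬ One A (i′ , j′)
  diagram-zero {i} {j} i′≤i j′≤j d one
    with ℕ.m≤n⇒m<n∨m≡n i′≤i | ℕ.m≤n⇒m<n∨m≡n j′≤j
  ... | inj₂ i′≡i | _ with refl ← toℕ-injective i′≡i = d (inj₁ (_ , j′≤j , one))
  ... | inj₁ _ | inj₂ j′≡j with refl ← toℕ-injective j′≡j = d (inj₂ (_ , i′≤i , one))
  ... | inj₁ i′<i | inj₁ j′<j
    -- Any 1 of row `i` lies outside the rows above `i`, so a path to it must leave the quadrant;
    -- the 1 where it does so shades `(i , j)`.
    with k , 1k ← noZeroRow i
    with leaves-quadrant A (toℕ i) (toℕ j) (path _ _ one 1k) i′<i j′<j (ℕ.<-irrefl refl ∘ proj₁)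
  ...   | _ , _ , 1q , inj₁ (k≡i , l<j) with refl ← toℕ-injective k≡i = d (inj₁ (_ , ℕ.<⇒≤ l<j , 1q))
  ...   | _ , _ , 1q , inj₂ (k<i , l≡j) with refl ← toℕ-injective l≡j = d (inj₂ (_ , ℕ.<⇒≤ k<i , 1q))

  diagram-down : ∀ {i j i′ j′} → i′ Fin.≤ i → j′ Fin.≤ j → Diagram A (i , j) → Diagram A (i′ , j′)
  diagram-down i≤ j≤ d (inj₁ (_ , l≤ , one)) = diagram-zero i≤ (ℕ.≤-trans l≤ j≤) d one
  diagram-down i≤ j≤ d (inj₂ (_ , k≤ , one)) = diagram-zero (ℕ.≤-trans k≤ i≤) j≤ d one

  diagram-rank : ∀ {p} → Diagram A p → rank A p ≡ 0
  diagram-rank {i , j} d = sum-zero λ k → sum-zero λ l → bit-zero (k Fin.≤? i) (l Fin.≤? j)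
    where
    bit-zero : ∀ {k l} (k≤?i : Dec (k Fin.≤ i)) (l≤?j : Dec (l Fin.≤ j)) →
               bit (does k≤?i ∧ does l≤?j ∧ entry A (k , l)) ≡ 0
    bit-zero (no _) _ = refl
    bit-zero (yes _) (no _) = refl
    bit-zero {k} {l} (yes k≤i) (yes l≤j) with entry A (k , l) in eq
    ... | false = refl
    ... | true  = contradiction eq (diagram-zero k≤i l≤j d)

  -- Moves down or right inside the diagram raise `toℕ i + toℕ j`, which stays below `m + n`. They
  -- must stop, and they stop only at an essential position. Thus the essential set determines the
  -- diagram.
  essential-beyond : ∀ {i j} → Diagram A (i , j) →
                     ∃₂ λ i′ j′ → i Fin.≤ i′ × j Fin.≤ j′ × Essential A (i′ , j′)
  essential-beyond {i} {j} = go (m + n) (ℕ.m≤m+n (m + n) (toℕ i + toℕ j))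
    where
    go : ∀ fuel {i j} → m + n ℕ.≤ fuel + (toℕ i + toℕ j) → Diagram A (i , j) →
         ∃₂ λ i′ j′ → i Fin.≤ i′ × j Fin.≤ j′ × Essential A (i′ , j′)
    go zero {i} {j} enough d = contradiction enough (ℕ.<⇒≱ (ℕ.+-mono-< (toℕ<n i) (toℕ<n j)))
    go (suc fuel) {i} {j} enough d
      with any? (λ i′ → toℕ i′ ℕ.≟ suc (toℕ i) ×-dec diagram? A (i′ , j))
         | any? (λ j′ → toℕ j′ ℕ.≟ suc (toℕ j) ×-dec diagram? A (i , j′))
    ... | yes (i₁ , i₁≡ , d₁) | _ =
      let i′ , j′ , i₁≤ , j≤ , ess = go fuel (subst (m + n ℕ.≤_) measure enough) d₁
      in i′ , j′ , ℕ.≤-trans (ℕ.n≤1+n _) (subst (ℕ._≤ toℕ i′) i₁≡ i₁≤) , j≤ , ess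
      where
      measure : suc fuel + (toℕ i + toℕ j) ≡ fuel + (toℕ i₁ + toℕ j)
      measure rewrite i₁≡ = sym (ℕ.+-suc fuel _)
    ... | no _ | yes (j₁ , j₁≡ , d₁) =
      let i′ , j′ , i≤ , j₁≤ , ess = go fuel (subst (m + n ℕ.≤_) measure enough) d₁
      in i′ , j′ , i≤ , ℕ.≤-trans (ℕ.n≤1+n _) (subst (ℕ._≤ toℕ j′) j₁≡ j₁≤) , ess
      where
      measure : suc fuel + (toℕ i + toℕ j) ≡ fuel + (toℕ i + toℕ j₁)
      measure rewrite j₁≡ | ℕ.+-suc (toℕ i) (toℕ j) = sym (ℕ.+-suc fuel _)
    ... | no noBelow | no noRight = i , j , ℕ.≤-refl , ℕ.≤-refl ,
      d , (λ i′ i′≡ d′ → noBelow (i′ , i′≡ , d′)) , (λ j′ j′≡ d′ → noRight (j′ , j′≡ , d′))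

  firstInRow : ∀ i → ∃ λ c → FirstInRow A (i , c)
  firstInRow i = least (λ c → one? A (i , c)) (noZeroRow i)

  -- Otherwise column c - 1 would have 1's both above and below row i, but
  -- none in row i.
  first-one-above-or-below : ∀ {i c} → FirstInRow A (i , c) →
    ∀ {k l k′ l′} → k Fin.< i → l Fin.< c → One A (k , l) →
    i Fin.< k′ → l′ Fin.< c → ¬ One A (k′ , l′)
  first-one-above-or-below {i} {c} first@(1c , zeros) k<i l<c 1k i<k′ l′<c 1k′
    with uses-previous-column A first (Fin._<? i) above (path _ _ 1k 1c) k<i l<c
       | uses-previous-column A first (i Fin.<?_) below (path _ _ 1k′ 1c) i<k′ l′<c
    where
    above : ∀ {k k′ : Fin m} → k Fin.< i → ¬ k′ Fin.< i → Consecutive k k′ ⊎ Consecutive k′ k → k′ ≡ i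
    above k<i k′≮i (inj₁ k′≡) = toℕ-injective (ℕ.≤-antisym (subst (ℕ._≤ toℕ i) (sym k′≡) k<i) (ℕ.≮⇒≥ k′≮i))
    above k<i k′≮i (inj₂ k≡)  = contradiction (ℕ.<-trans (ℕ.≤-reflexive (sym k≡)) k<i) k′≮i
    below : ∀ {k k′ : Fin m} → i Fin.< k → ¬ i Fin.< k′ → Consecutive k k′ ⊎ Consecutive k′ k → k′ ≡ i
    below i<k i≮k′ (inj₁ k′≡) = contradiction (ℕ.<-trans i<k (ℕ.≤-reflexive (sym k′≡))) i≮k′
    below i<k i≮k′ (inj₂ k≡)  = toℕ-injective
      (ℕ.≤-antisym (ℕ.≮⇒≥ i≮k′) (ℕ.≤-pred (subst (suc (toℕ i) ℕ.≤_) k≡ i<k)))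
  ... | _ , p , k₁<i , p+1≡c , 1p | _ , q , i<k₂ , q+1≡c , 1q
    with refl ← toℕ-injective {i = p} {q} (ℕ.suc-injective (trans p+1≡c (sym q+1≡c))) =
    zeros p (ℕ.≤-reflexive p+1≡c) (cols p (ℕ.<⇒≤ k₁<i) (ℕ.<⇒≤ i<k₂) 1p 1q)

  -- If a 1 above row `i` shaded a column left of `c`, then row `i` would have 1's left of `c` both
  -- above it and below it, the latter at `(f , z)`; for `i` equal to `f`, the 1 at `(f , z)` itself
  -- precedes `c`. The first column is given as `z` with `toℕ z ≡ 0` because `n` is not a successor
  -- here.
  first-one-first-shaded : ∀ {i c} → FirstInRow A (i , c) →
    ∀ {f z} → i Fin.≤ f → toℕ z ≡ 0 → One A (f , z) →
    ∀ {l} → Shaded A (i , l) → c Fin.≤ l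
  first-one-first-shaded (_ , zeros) i≤f z≡0 1f (inj₁ (l₀ , l₀≤l , 1l₀)) =
    ℕ.≮⇒≥ λ l<c → zeros l₀ (ℕ.≤-<-trans l₀≤l l<c) 1l₀
  first-one-first-shaded first@(_ , zeros) {f} {z} i≤f z≡0 1f {l} (inj₂ (i₀ , i₀≤i , 1i₀))
    = ℕ.≮⇒≥ λ l<c → absurd l<c (subst (ℕ._< _) (sym z≡0) (ℕ.≤-<-trans z≤n l<c))
    where
    absurd : l Fin.< _ → ¬ z Fin.< _
    absurd l<c z<c with ℕ.m≤n⇒m<n∨m≡n i₀≤i | ℕ.m≤n⇒m<n∨m≡n i≤f
    ... | inj₂ i₀≡i | _ with refl ← toℕ-injective i₀≡i = zeros l l<c 1i₀
    ... | inj₁ _ | inj₂ i≡f with refl ← toℕ-injective i≡f = zeros z z<c 1f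
    ... | inj₁ i₀<i | inj₁ i<f = first-one-above-or-below first i₀<i l<c 1i₀ i<f z<c 1f

-- The diagram of a polyomino

module _ {m n} {A : Matrix m n} (poly : Polyomino A) where
  open PolyominoProperties poly

  private
    rowLength : ∀ i → ∃ λ u → u ℕ.≤ n × (∀ j → Diagram A (i , j) ⇔ toℕ j ℕ.< u)
    rowLength i = downset-initial (λ j → diagram? A (i , j)) (diagram-down ℕ.≤-refl)

  diagramShape : Vec ℕ m
  diagramShape = tabulate (proj₁ ∘ rowLength)

  private
    U : Vec ℕ m
    U = diagramShape

    U≤n : ∀ i → lookup U i ℕ.≤ n
    U≤n i rewrite lookup∘tabulate (proj₁ ∘ rowLength) i = proj₁ (proj₂ (rowLength i))

    diagram⇔ : ∀ i j → Diagram A (i , j) ⇔ toℕ j ℕ.< lookup U i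
    diagram⇔ i j rewrite lookup∘tabulate (proj₁ ∘ rowLength) i = proj₂ (proj₂ (rowLength i)) j

    to : ∀ {i j} → Diagram A (i , j) → toℕ j ℕ.< lookup U i
    to = Equivalence.to (diagram⇔ _ _)

    from : ∀ {i j} → toℕ j ℕ.< lookup U i → Diagram A (i , j)
    from = Equivalence.from (diagram⇔ _ _)

    U-nonincreasing : ∀ {i i′} → i Fin.≤ i′ → lookup U i′ ℕ.≤ lookup U i
    -- The witness is the column with 0-based index `lookup U i`, the first one past the diagram in
    -- row `i`: it would lie in the diagram in row `i′`, hence also in row `i`.
    U-nonincreasing {i} {i′} i≤i′ = ℕ.≮⇒≥ λ u<u′ →
      let u<n = ℕ.<-≤-trans u<u′ (U≤n i′)
          j≡u = toℕ-fromℕ< u<n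
          d   = from (subst (ℕ._< lookup U i′) (sym j≡u) u<u′)
      in ℕ.<-irrefl j≡u (to (diagram-down i≤i′ ℕ.≤-refl d))

    essential⇒corner : ∀ {i j} → Essential A (i , j) → LowerRightCorner U (i , j)
    essential⇒corner {i} {j} (d , noBelow , noRight) = j+1≡u , below<u
      where
      j+1≡u : suc (toℕ j) ≡ lookup U i
      -- If `u` exceeded `j + 1`, the right neighbour would exist, since `u` is at most `n`, and
      -- would lie in the diagram.
      j+1≡u = ℕ.≤-antisym (to d) (ℕ.≮⇒≥ λ j+1<u →
        let j+1<n = ℕ.<-≤-trans j+1<u (U≤n i)
            j′≡   = toℕ-fromℕ< j+1<n
        in noRight (fromℕ< j+1<n) j′≡ (from (subst (ℕ._< lookup U i) (sym j′≡) j+1<u)))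
      below<u : lookup (U ∷ʳ 0) (suc i) ℕ.< lookup U i
      below<u with lookup-∷ʳ U 0 (suc i)
      ... | inj₁ (i′ , i′≡ , eq) rewrite eq = ℕ.≤-<-trans (ℕ.≮⇒≥ (noBelow i′ i′≡ ∘ from)) (to d)
      ... | inj₂ (_ , eq)        rewrite eq = ℕ.≤-<-trans z≤n (to d)

    corner⇒essential : ∀ {i j} → LowerRightCorner U (i , j) → Essential A (i , j)
    corner⇒essential {i} {j} (j+1≡u , below<u) = from (ℕ.≤-reflexive j+1≡u) , noBelow , noRight
      where
      noBelow : ∀ i′ → Consecutive i i′ → ¬ Diagram A (i′ , j)
      noBelow i′ i′≡ d with lookup-∷ʳ U 0 (suc i)
      ... | inj₂ (i+1≡m , _) = ℕ.<-irrefl (trans i′≡ i+1≡m) (toℕ<n i′)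
      ... | inj₁ (i″ , i″≡ , eq) with refl ← toℕ-injective (trans i″≡ (sym i′≡)) =
        ℕ.<⇒≱ (subst (ℕ._< lookup U i) eq below<u) (subst (ℕ._≤ lookup U i′) j+1≡u (to d))
      noRight : ∀ j′ → Consecutive j j′ → ¬ Diagram A (i , j′)
      noRight j′ j′≡ d = ℕ.<-irrefl (trans j′≡ j+1≡u) (to d)

  diagramShape-ferrers : FerrersVector n diagramShape
  diagramShape-ferrers = record { nonincreasing = U-nonincreasing ; fits = U≤n }

  diagram≐ferrers : Diagram A ≐ Ferrers diagramShape
  diagram≐ferrers = to , from

  rankedEssential≐corners : RankedEssential A ≐ (λ (p , r) → LowerRightCorner diagramShape p × r ≡ 0)
  rankedEssential≐corners =
      (λ (ess , r≡) → essential⇒corner ess , trans r≡ (diagram-rank (proj₁ ess)))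
    , (λ (corner , r≡0) → let ess = corner⇒essential corner
                          in ess , trans r≡0 (sym (diagram-rank (proj₁ ess))))

-- Uniqueness

-- A diagram position of `A` lies weakly north-west of an essential position of `A`. That position
-- is in the diagram of `B`, which is closed towards the north-west.
diagram-⊆ : ∀ {m n} {A B : Matrix m n} → Polyomino A → Polyomino B →
            (∀ {p} → RankedEssential A p → RankedEssential B p) →
            ∀ {p} → Diagram A p → Diagram B p
diagram-⊆ polyA polyB A⊆B d =
  let _ , _ , i≤ , j≤ , ess = PolyominoProperties.essential-beyond polyA d
  in PolyominoProperties.diagram-down polyB i≤ j≤ (proj₁ (proj₁ (A⊆B (ess , refl))))

shaded-antitone : ∀ {m n} (A B : Matrix m n) → (∀ {p} → Diagram A p → Diagram B p) →
                  ∀ {p} → Shaded B p → Shaded A p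
shaded-antitone A B A⊆B {p} s = decidable-stable (shaded? A p) λ d → A⊆B d s

first-column-shaded : ∀ {m n} {A : Matrix m (suc n)} {i} → Shaded A (i , zero) →
                      ∃ λ k → k Fin.≤ i × One A (k , zero)
first-column-shaded {i = i} (inj₁ (zero , _ , one)) = i , ℕ.≤-refl , one
first-column-shaded         (inj₂ k)                = k

entries-determine : ∀ {m n} {A B : Matrix m n} →
                    (∀ i j → entry A (i , j) ≡ entry B (i , j)) → A ≡ B
entries-determine A≡B = Pointwise-≡⇒≡ (ext λ i → Pointwise-≡⇒≡ (ext (A≡B i)))

module Uniqueness {m n} {A B : Matrix m n} (polyA : Polyomino A) (polyB : Polyomino B)
                  (rowSum≡ : ∀ i → rowSum A i ≡ rowSum B i)
                  (colSum≡ : ∀ j → colSum A j ≡ colSum B j) where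
  private
    module A = PolyominoProperties polyA
    module B = PolyominoProperties polyB

  AgreeAt : Fin m → Fin n → Set
  AgreeAt i j = entry A (i , j) ≡ entry B (i , j)

  row-unique : ∀ {i j} → One A (i , j) → (∀ l → l Fin.≤ j → AgreeAt i l) → ∀ l → AgreeAt i l
  row-unique {i} {j} 1j agree = interval-unique (A.rows i) (B.rows i) (rowSum≡ i)
    1j (trans (sym (agree j ℕ.≤-refl)) 1j) agree

  col-unique : ∀ {i j} → One A (i , j) → (∀ k → k Fin.≤ i → AgreeAt k j) → ∀ k → AgreeAt k j
  col-unique {i} {j} 1i agree = interval-unique (A.cols j) (B.cols j) (colSum≡ j)
    1i (trans (sym (agree i ℕ.≤-refl)) 1i) agree

  -- The disjunction makes this an L-shaped region of whole rows and whole columns, not a quadrant.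
  AgreeOn : ℕ → ℕ → Set
  AgreeOn a b = ∀ i j → toℕ i ℕ.< a ⊎ toℕ j ℕ.< b → AgreeAt i j

  -- Row `a` up to its 1 in column `l` lies in columns where agreement is known, so its sum fixes
  -- the rest.
  extend-row : ∀ {a b k l} → AgreeOn a b → One A (k , l) → toℕ k ≡ a → toℕ l ℕ.< b → AgreeOn (suc a) b
  extend-row agree 1kl refl l<b i j (inj₂ j<b) = agree i j (inj₂ j<b)
  extend-row {k = k} agree 1kl refl l<b i j (inj₁ i<1+k) with ℕ.m≤n⇒m<n∨m≡n (ℕ.≤-pred i<1+k)
  ... | inj₁ i<k = agree i j (inj₁ i<k)
  ... | inj₂ i≡k with refl ← toℕ-injective i≡k =
    row-unique 1kl (λ l′ l′≤l → agree k l′ (inj₂ (ℕ.≤-<-trans l′≤l l<b))) j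

  extend-col : ∀ {a b k l} → AgreeOn a b → One A (k , l) → toℕ k ℕ.< a → toℕ l ≡ b → AgreeOn a (suc b)
  extend-col agree 1kl k<a refl i j (inj₁ i<a) = agree i j (inj₁ i<a)
  extend-col {l = l} agree 1kl k<a refl i j (inj₂ j<1+l) with ℕ.m≤n⇒m<n∨m≡n (ℕ.≤-pred j<1+l)
  ... | inj₁ j<l = agree i j (inj₂ j<l)
  ... | inj₂ j≡l with refl ← toℕ-injective j≡l =
    col-unique 1kl (λ k′ k′≤k → agree k′ l (inj₁ (ℕ.≤-<-trans k′≤k k<a))) i

  agree-everywhere : ∀ fuel {a b f g} → m + n ℕ.≤ fuel + (a + b) → One A (f , g) →
                     toℕ f ℕ.< a → toℕ g ℕ.< b → AgreeOn a b → ∀ i j → AgreeAt i j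
  agree-everywhere fuel {a} {b} enough 1fg f<a g<b agree i j with m ℕ.≤? a | n ℕ.≤? b
  ... | yes m≤a | _       = agree i j (inj₁ (ℕ.<-≤-trans (toℕ<n i) m≤a))
  ... | no  _   | yes n≤b = agree i j (inj₂ (ℕ.<-≤-trans (toℕ<n j) n≤b))
  -- Each extension raises `a + b` by one, so fuel cannot run out while `a` is below `m` and `b`
  -- below `n`.
  agree-everywhere zero enough _ _ _ _ i j | no m≰a | no n≰b =
    contradiction enough (ℕ.<⇒≱ (ℕ.+-mono-< (ℕ.≰⇒> m≰a) (ℕ.≰⇒> n≰b)))
  agree-everywhere (suc fuel) {a} {b} enough 1fg f<a g<b agree i j | no m≰a | no n≰b
    -- The row with index `a` contains a 1, and a path to it from `(f , g)` has to leave the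
    -- quadrant.
    with l , 1l ← A.noZeroRow (fromℕ< (ℕ.≰⇒> m≰a))
    with leaves-quadrant A a b (A.path _ _ 1fg 1l) f<a g<b
           (ℕ.<-irrefl (toℕ-fromℕ< (ℕ.≰⇒> m≰a)) ∘ proj₁)
  ... | _ , _ , 1kl , inj₁ (k≡a , l<b) = agree-everywhere fuel
    (subst (m + n ℕ.≤_) (sym (ℕ.+-suc fuel (a + b))) enough)
    1fg (ℕ.m<n⇒m<1+n f<a) g<b (extend-row agree 1kl k≡a l<b) i j
  ... | _ , _ , 1kl , inj₂ (k<a , l≡b) = agree-everywhere fuel
    (subst (m + n ℕ.≤_) (trans (sym (ℕ.+-suc fuel (a + b))) (cong (fuel +_) (sym (ℕ.+-suc a b)))) enough)
    1fg f<a (ℕ.m<n⇒m<1+n g<b) (extend-col agree 1kl k<a l≡b) i j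

  upper-row-agrees : (∀ {p} → Shaded A p → Shaded B p) → (∀ {p} → Shaded B p → Shaded A p) →
                     ∀ {f z i} → toℕ z ≡ 0 → One A (f , z) → One B (f , z) → i Fin.≤ f →
                     ∀ j → AgreeAt i j
  upper-row-agrees A⇒B B⇒A {i = i} z≡0 1A 1B i≤f
    with cA , firstA@(1cA , zerosA) ← A.firstInRow i | cB , firstB@(1cB , zerosB) ← B.firstInRow i
    -- The first 1 of either matrix is shaded in the other, so neither first 1 comes later than the
    -- other.
    with refl ← toℕ-injective {i = cA} {cB} (ℕ.≤-antisym
      (A.first-one-first-shaded firstA i≤f z≡0 1A (B⇒A (inj₁ (cB , ℕ.≤-refl , 1cB))))
      (B.first-one-first-shaded firstB i≤f z≡0 1B (A⇒B (inj₁ (cA , ℕ.≤-refl , 1cA)))))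
    = row-unique 1cA agree
    where
    agree : ∀ l → l Fin.≤ cA → AgreeAt i l
    agree l l≤c with ℕ.m≤n⇒m<n∨m≡n l≤c
    ... | inj₂ l≡c with refl ← toℕ-injective l≡c = trans 1cA (sym 1cB)
    ... | inj₁ l<c = ⇔→≡ {z = true} (mk⇔
      (λ 1l → contradiction 1l (zerosA l l<c)) (λ 1l → contradiction 1l (zerosB l l<c)))

polyomino-unique : ∀ {m n} {A B : Matrix m n} → Polyomino A → Polyomino B →
                   (∀ i → rowSum A i ≡ rowSum B i) → (∀ j → colSum A j ≡ colSum B j) →
                   Diagram A ≐ Diagram B → ∀ i j → entry A (i , j) ≡ entry B (i , j)
polyomino-unique {n = zero} _ _ _ _ _ _ ()
polyomino-unique {m} {suc n} {A} {B} polyA polyB rowSum≡ colSum≡ (A⊆B , B⊆A)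
  with fA , 1A , leastA ← least (λ i → one? A (i , zero)) (PolyominoProperties.noZeroCol polyA zero)
     | fB , 1B , leastB ← least (λ i → one? B (i , zero)) (PolyominoProperties.noZeroCol polyB zero)
  = start (toℕ-injective (ℕ.≤-antisym fA≤fB fB≤fA))
  where
  open Uniqueness polyA polyB rowSum≡ colSum≡
  A⇒B : ∀ {p} → Shaded A p → Shaded B p
  A⇒B = shaded-antitone B A B⊆A
  B⇒A : ∀ {p} → Shaded B p → Shaded A p
  B⇒A = shaded-antitone A B A⊆B
  fA≤fB : fA Fin.≤ fB
  -- Position `(fB , zero)` is shaded in `B`, hence in `A`. In the first column this takes a 1 of
  -- `A` at or above row `fB`, and `fA` is the topmost row with such a 1.
  fA≤fB with k , k≤ , 1k ← first-column-shaded {A = A} (B⇒A (inj₂ (fB , ℕ.≤-refl , 1B))) =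
    ℕ.≮⇒≥ λ fB<fA → leastA k (ℕ.≤-<-trans k≤ fB<fA) 1k
  fB≤fA : fB Fin.≤ fA
  fB≤fA with k , k≤ , 1k ← first-column-shaded {A = B} (A⇒B (inj₂ (fA , ℕ.≤-refl , 1A))) =
    ℕ.≮⇒≥ λ fA<fB → leastB k (ℕ.≤-<-trans k≤ fA<fB) 1k
  start : fA ≡ fB → ∀ i j → AgreeAt i j
  -- The starting region consists of the rows up to `fA` and the first column, which share the 1 at
  -- `(fA , zero)`.
  start refl = agree-everywhere (m + suc n) (ℕ.m≤m+n _ _) 1A ℕ.≤-refl (s≤s z≤n) agree
    where
    upper : ∀ i → i Fin.≤ fA → ∀ j → AgreeAt i j
    upper i = upper-row-agrees A⇒B B⇒A refl 1A 1B
    agree : AgreeOn (suc (toℕ fA)) 1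
    agree i j    (inj₁ (s≤s i≤f)) = upper i i≤f j
    agree i zero (inj₂ _)         = col-unique 1A (λ k k≤f → upper k k≤f zero) i
    agree i (suc j) (inj₂ (s≤s ()))

mainTheorem2 : (∀ (m n : ℕ) (A : Matrix m n) → Polyomino A →
    ∃ λ (U : Vec ℕ m) →
    FerrersVector n U
    × Diagram A ≐ Ferrers U
    × RankedEssential A ≐ (λ (p , r) → LowerRightCorner U p × r ≡ 0))
    × (∀ (m n : ℕ) (R : Vec ℕ m) (S : Vec ℕ n) (A B : Matrix m n) →
    Polyomino A → 𝒞 R S A →
    Polyomino B → 𝒞 R S B →
    RankedEssential A ≐ RankedEssential B →
    A ≡ B)
mainTheorem2 =
    (λ m n A poly → diagramShape poly , diagramShape-ferrers poly ,
                    diagram≐ferrers poly , rankedEssential≐corners poly)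
  , (λ m n R S A B polyA A∈𝒞 polyB B∈𝒞 (A⊆B , B⊆A) → entries-determine
      (polyomino-unique polyA polyB
        (λ i → trans (𝒞.rowSums A∈𝒞 i) (sym (𝒞.rowSums B∈𝒞 i)))
        (λ j → trans (𝒞.colSums A∈𝒞 j) (sym (𝒞.colSums B∈𝒞 j)))
        (diagram-⊆ polyA polyB A⊆B , diagram-⊆ polyB polyA B⊆A)))
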